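{- Let $G$ be a graph with edge set $E$, $k\ge1$, suppose $M_k(G)$ is a connected matroid, let $B$ be a base of $M_k(G)$ and $e\in B$, and let $A$ be the component of $G\langle B\rangle$ containing $e$. Suppose $A$ has exactly one cycle and $e$ lies on that cycle (i.e. $e\in E(\lfloor A\rfloor)$). Then $A\setminus e$ is a tree and the fundamental cocircuit $K(e,B)$ equals $\{e\}\cup\{u\in E\setminus B: u\text{ has at least one end-vertex in } V(A)\}$.
   Context: Graphs are finite, may have loops and parallel edges, and have no isolated vertices; $A\setminus e$ deletes the edge $e$ and keeps all vertices. A leaf is a vertex incident to exactly one edge, which is not a loop. For $X\subseteq E$, $G\langle X\rangle$ is the subgraph with edge set $X$ and vertex set the vertices incident to $X$. For $k\ge0$, $M_k(G)$ is the matroid on $E$ whose circuits are the inclusion-minimal members of $\{C\subseteq E:C\neq\emptyset,\ |C|=|V(G\langle C\rangle)|+k\}$. A matroid is connected if its ground set has at least two elements and every two elements lie in a common circuit. For a base $B$ and $e\in B$, $K(e,B)$ is the unique cocircuit $K$ with $K\cap B=\{e\}$. For a connected graph $A$ containing a cycle, its kernel $\lfloor A\rfloor$ is the subgraph obtained by repeatedly deleting leaves (with their incident edges) until no leaf remains. -}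

module Defs where

open import Data.Empty using (⊥-elim)
open import Data.Fin.Base using (Fin)
open import Data.Fin.Properties using (any?) renaming (_≟_ to _≟F_)
open import Data.Fin.Subset
open import Data.Fin.Subset.Properties
open import Data.List.Base using (List; []; _∷_)
open import Data.List.Relation.Unary.Unique.Propositional using (Unique)
open import Data.Nat.Base using (ℕ; zero; suc; _+_; _≤_; _<_; s≤s; s≤s⁻¹; z≤n)
open import Data.Nat.Induction using (<-wellFounded)
open import Data.Nat.Properties
open import Data.Product.Base using (Σ-syntax; ∃-syntax; _×_; _,_; proj₁; proj₂)
open import Data.Sum.Base using (_⊎_; inj₁; inj₂)
open import Data.Vec.Base using ([]; _∷_; tabulate)
open import Data.Vec.Properties using (lookup∘tabulate; []=⇒lookup; lookup⇒[]=)
open import Function.Base using (_∘_)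
open import Induction.WellFounded using (Acc; acc)
open import Relation.Binary.Construct.Closure.ReflexiveTransitive using (Star)
open import Relation.Binary.PropositionalEquality
open import Relation.Nullary using (¬_; Dec; yes; no; does)
open import Relation.Nullary.Decidable using (_×-dec_; _⊎-dec_; ¬?; dec-true)
open import Relation.Unary using (Decidable)

module _ {m : ℕ} where

  Minimal : (Subset m → Set) → Subset m → Set
  Minimal P X = P X × (∀ Y → P Y → Y ⊆ X → Y ≡ X)

  Maximal : (Subset m → Set) → Subset m → Set
  Maximal P X = P X × (∀ Y → P Y → X ⊆ Y → Y ≡ X)

  select : {P : Fin m → Set} → Decidable P → Subset m
  select P? = tabulate (does ∘ P?)

  ∈-select⁺ : {P : Fin m → Set} (P? : Decidable P) → ∀ {x} → P x → x ∈ select P?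
  ∈-select⁺ P? {x} p =
    lookup⇒[]= x _ (trans (lookup∘tabulate (does ∘ P?) x) (dec-true (P? x) p))

  ∈-select⁻ : {P : Fin m → Set} (P? : Decidable P) → ∀ {x} → x ∈ select P? → P x
  ∈-select⁻ P? {x} x∈ with P? x | trans (sym (lookup∘tabulate (does ∘ P?) x)) ([]=⇒lookup x∈)
  ... | yes p | _  = p
  ... | no  _ | ()

record Matroid (m : ℕ) : Set₁ where
  field
    Circuit     : Subset m → Set
    nonempty    : ∀ C → Circuit C → Nonempty C
    antichain   : ∀ C D → Circuit C → Circuit D → C ⊆ D → C ≡ D
    elimination : ∀ C D e → Circuit C → Circuit D → C ≢ D → e ∈ C → e ∈ D →
                  ∃[ F ] Circuit F × F ⊆ (C ∪ D) - e

  Independent : Subset m → Set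
  Independent X = ∀ C → Circuit C → ¬ (C ⊆ X)

  Base : Subset m → Set
  Base = Maximal Independent

  -- X is independent in the dual matroid, whose bases are the complements
  -- of bases.
  Coindependent : Subset m → Set
  Coindependent X = ∃[ B ] Base B × X ⊆ ∁ B

  Cocircuit : Subset m → Set
  Cocircuit = Minimal (λ X → ¬ Coindependent X)

  Connected : Set
  Connected = 2 ≤ m × (∀ e f → e ≢ f → ∃[ C ] Circuit C × e ∈ C × f ∈ C)

  -- "K is K(e, B)", including the uniqueness built into that notation.
  FundamentalCocircuit : Subset m → Fin m → Subset m → Set
  FundamentalCocircuit B e K =
    (Cocircuit K × K ∩ B ≡ ⁅ e ⁆) ×
    (∀ K′ → Cocircuit K′ → K′ ∩ B ≡ ⁅ e ⁆ → K′ ≡ K)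

-- Edges are undirected: the order of the two ends of an edge is an
-- artefact of the representation, and no definition below depends on it.
-- A loop has equal ends.
record Graph : Set where
  field
    order : ℕ
    size  : ℕ
    ends  : Fin size → Fin order × Fin order

  Vertex : Set
  Vertex = Fin order

  Edge : Set
  Edge = Fin size

  Incident : Edge → Vertex → Set
  Incident e v = proj₁ (ends e) ≡ v ⊎ proj₂ (ends e) ≡ v

  field
    noIsolated : ∀ v → ∃[ e ] Incident e v

  VertexSet EdgeSet : Set
  VertexSet = Subset order
  EdgeSet   = Subset size

  Joins : Edge → Vertex → Vertex → Set
  Joins e u v = ends e ≡ (u , v) ⊎ ends e ≡ (v , u)

  Loop : Edge → Set
  Loop e = proj₁ (ends e) ≡ proj₂ (ends e)

  incident? : ∀ e v → Dec (Incident e v)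
  incident? e v = (proj₁ (ends e) ≟F v) ⊎-dec (proj₂ (ends e) ≟F v)

  Covered : EdgeSet → Vertex → Set
  Covered X v = ∃[ e ] e ∈ X × Incident e v

  covered? : ∀ X → Decidable (Covered X)
  covered? X v = any? (λ e → (e ∈? X) ×-dec incident? e v)

  cover : EdgeSet → VertexSet
  cover X = select (covered? X)

-- Unlike graphs, subgraphs may have isolated vertices.
record Subgraph (G : Graph) : Set where
  open Graph G
  field
    V      : VertexSet
    E      : EdgeSet
    closed : ∀ e v → e ∈ E → Incident e v → v ∈ V

open Subgraph public using (V; E)

_⟨_⟩ : (G : Graph) → Graph.EdgeSet G → Subgraph G
G ⟨ X ⟩ = record
  { V      = cover X
  ; E      = X
  ; closed = λ e v e∈X i → ∈-select⁺ (covered? X) (e , e∈X , i)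
  }
  where open Graph G

module _ {G : Graph} where
  open Graph G

  infix  4 _≤G_
  infixl 5 _∖_

  _≤G_ : Subgraph G → Subgraph G → Set
  A ≤G H = V A ⊆ V H × E A ⊆ E H

  _∖_ : Subgraph G → Edge → Subgraph G
  A ∖ e = record
    { V      = V A
    ; E      = E A - e
    ; closed = λ f v f∈ → Subgraph.closed A f v (p─q⊆p (E A) ⁅ e ⁆ f∈)
    }

  data Walk (H : Subgraph G) : Vertex → Vertex → Set where
    stop : ∀ {v} → v ∈ V H → Walk H v v
    step : ∀ {u v w} (f : Edge) → f ∈ E H → Joins f u v → Walk H v w → Walk H u w

  vertices : ∀ {H u v} → Walk H u v → List Vertex
  vertices {v = v} (stop _)       = v ∷ []
  vertices {u = u} (step _ _ _ P) = u ∷ vertices P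

  edges : ∀ {H u v} → Walk H u v → EdgeSet
  edges (stop _)       = ⊥
  edges (step f _ _ P) = ⁅ f ⁆ ∪ edges P

  ConnectedGraph : Subgraph G → Set
  ConnectedGraph H = Nonempty (V H) × (∀ u v → u ∈ V H → v ∈ V H → Walk H u v)

  Component : Subgraph G → Subgraph G → Set
  Component H A =
    A ≤G H × ConnectedGraph A ×
    (∀ A′ → A′ ≤G H → ConnectedGraph A′ → A ≤G A′ → A′ ≤G A)

  -- C is the edge set of a cycle of H: a path P (no repeated vertex) together
  -- with a further edge f joining its ends.  A one-vertex P gives a loop, a
  -- one-edge P a pair of parallel edges.  A cycle is determined by its edge
  -- set, so cycles are counted as edge sets.
  Cycle : Subgraph G → EdgeSet → Set
  Cycle H C =
    ∃[ u ] ∃[ v ] Σ[ P ∈ Walk H u v ] ∃[ f ]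
      Unique (vertices P) × f ∈ E H × Joins f u v × f ∉ edges P ×
      C ≡ ⁅ f ⁆ ∪ edges P

  Tree : Subgraph G → Set
  Tree H = ConnectedGraph H × (∀ C → ¬ Cycle H C)

  -- v is a leaf of H, and f is the edge of H incident to it
  Leaf : Subgraph G → Vertex → Edge → Set
  Leaf H v f =
    v ∈ V H × f ∈ E H × Incident f v × ¬ Loop f ×
    (∀ g → g ∈ E H → Incident g v → g ≡ f)

  LeafDeletion : Subgraph G → Subgraph G → Set
  LeafDeletion H H′ =
    ∃[ v ] ∃[ f ] Leaf H v f × V H′ ≡ V H - v × E H′ ≡ E H - f

  -- Q = ⌊ A ⌋
  Kernel : Subgraph G → Subgraph G → Set
  Kernel A Q = Star LeafDeletion A Q × (∀ v f → ¬ Leaf Q v f)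

∣∪∣+∣∩∣ : ∀ {m} (p q : Subset m) → ∣ p ∪ q ∣ + ∣ p ∩ q ∣ ≡ ∣ p ∣ + ∣ q ∣
∣∪∣+∣∩∣ []            []            = refl
∣∪∣+∣∩∣ (outside ∷ p) (outside ∷ q) = ∣∪∣+∣∩∣ p q
∣∪∣+∣∩∣ (outside ∷ p) (inside  ∷ q) =
  trans (cong suc (∣∪∣+∣∩∣ p q)) (sym (+-suc ∣ p ∣ ∣ q ∣))
∣∪∣+∣∩∣ (inside  ∷ p) (outside ∷ q) = cong suc (∣∪∣+∣∩∣ p q)
∣∪∣+∣∩∣ (inside  ∷ p) (inside  ∷ q) = cong suc
  (trans (+-suc _ _) (trans (cong suc (∣∪∣+∣∩∣ p q)) (sym (+-suc ∣ p ∣ ∣ q ∣))))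

∣p∣≤1+∣p-x∣ : ∀ {m} (p : Subset m) x → ∣ p ∣ ≤ suc ∣ p - x ∣
∣p∣≤1+∣p-x∣ p x = begin
  ∣ p ∣                                  ≤⟨ p⊆q⇒∣p∣≤∣q∣ sub ⟩
  ∣ ⁅ x ⁆ ∪ (p - x) ∣                    ≤⟨ m≤m+n _ _ ⟩
  ∣ ⁅ x ⁆ ∪ (p - x) ∣ + ∣ ⁅ x ⁆ ∩ (p - x) ∣ ≡⟨ ∣∪∣+∣∩∣ ⁅ x ⁆ (p - x) ⟩
  ∣ ⁅ x ⁆ ∣ + ∣ p - x ∣                  ≡⟨ cong (_+ ∣ p - x ∣) (∣⁅x⁆∣≡1 x) ⟩
  suc ∣ p - x ∣                          ∎
  where
  open ≤-Reasoning
  sub : p ⊆ ⁅ x ⁆ ∪ (p - x)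
  sub {y} y∈p with y ≟F x
  ... | yes refl = x∈p∪q⁺ (inj₁ (x∈⁅x⁆ x))
  ... | no  y≢x  = x∈p∪q⁺ (inj₂ (x∈p∧x≢y⇒x∈p-y y∈p y≢x))

nonempty⇒0< : ∀ {m} {p : Subset m} → Nonempty p → 0 < ∣ p ∣
nonempty⇒0< (x , x∈p) = ≤-trans (s≤s z≤n) (x∈p⇒∣p-x∣<∣p∣ x∈p)

0<⇒nonempty : ∀ {m} {p : Subset m} → 0 < ∣ p ∣ → Nonempty p
0<⇒nonempty {m} {p} 0<p with nonempty? p
... | yes ne = ne
... | no  em with Empty-unique em
...   | refl = ⊥-elim (<-irrefl (sym (∣⊥∣≡0 m)) 0<p)

minimal-below : ∀ {m} {P : Subset m → Set} → Decidable P →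
                ∀ X → P X → ∃[ C ] Minimal P C × C ⊆ X
minimal-below {P = P} P? X pX = go X pX (<-wellFounded ∣ X ∣)
  where
  go : ∀ X → P X → Acc _<_ ∣ X ∣ → ∃[ C ] Minimal P C × C ⊆ X
  go X pX (acc rs) with anySubset? (λ Y → P? Y ×-dec (Y ⊂? X))
  ... | yes (Y , pY , Y⊂X) with go Y pY (rs (p⊂q⇒∣p∣<∣q∣ Y⊂X))
  ...   | C , minC , C⊆Y = C , minC , ⊆-trans C⊆Y (p⊂q⇒p⊆q Y⊂X)
  go X pX (acc rs) | no none = X , (pX , least) , ⊆-refl
    where
    least : ∀ Y → P Y → Y ⊆ X → Y ≡ X
    least Y pY Y⊆X with X ⊆? Y
    ... | yes X⊆Y = ⊆-antisym Y⊆X X⊆Y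
    ... | no  X⊈Y with any? (λ x → (x ∈? X) ×-dec ¬? (x ∈? Y))
    ...   | yes w  = ⊥-elim (none (Y , pY , Y⊆X , w))
    ...   | no  ¬w = ⊥-elim (X⊈Y X⊆Y)
      where
      X⊆Y : X ⊆ Y
      X⊆Y {x} x∈X with x ∈? Y
      ... | yes x∈Y = x∈Y
      ... | no  x∉Y = ⊥-elim (¬w (x , x∈X , x∉Y))

module _ (k : ℕ) (G : Graph) where
  open Graph G

  -- V (G ⟨ C ⟩) is cover C by definition.
  Candidate : EdgeSet → Set
  Candidate C = Nonempty C × ∣ C ∣ ≡ ∣ V (G ⟨ C ⟩) ∣ + k

  candidate? : Decidable Candidate
  candidate? C = nonempty? C ×-dec (∣ C ∣ ≟ ∣ cover C ∣ + k)

  cover-mono : ∀ {X Y} → X ⊆ Y → cover X ⊆ cover Y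
  cover-mono {X} {Y} X⊆Y v∈ with ∈-select⁻ (covered? X) v∈
  ... | e , e∈X , i = ∈-select⁺ (covered? Y) (e , X⊆Y e∈X , i)

  cover-∪ : ∀ X Y → cover (X ∪ Y) ⊆ cover X ∪ cover Y
  cover-∪ X Y v∈ with ∈-select⁻ (covered? (X ∪ Y)) v∈
  ... | e , e∈ , i with x∈p∪q⁻ X Y e∈
  ...   | inj₁ e∈X = x∈p∪q⁺ (inj₁ (∈-select⁺ (covered? X) (e , e∈X , i)))
  ...   | inj₂ e∈Y = x∈p∪q⁺ (inj₂ (∈-select⁺ (covered? Y) (e , e∈Y , i)))

  cover-∩ : ∀ X Y → cover (X ∩ Y) ⊆ cover X ∩ cover Y
  cover-∩ X Y v∈ =
    x∈p∩q⁺ (cover-mono (p∩q⊆p X Y) v∈ , cover-mono (p∩q⊆q X Y) v∈)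

  cover-submodular : ∀ X Y →
    ∣ cover (X ∪ Y) ∣ + ∣ cover (X ∩ Y) ∣ ≤ ∣ cover X ∣ + ∣ cover Y ∣
  cover-submodular X Y = ≤-trans
    (+-mono-≤ (p⊆q⇒∣p∣≤∣q∣ (cover-∪ X Y)) (p⊆q⇒∣p∣≤∣q∣ (cover-∩ X Y)))
    (≤-reflexive (∣∪∣+∣∩∣ (cover X) (cover Y)))

  0<cover : ∀ {X} → Nonempty X → 0 < ∣ cover X ∣
  0<cover {X} (e , e∈X) = nonempty⇒0<
    (proj₁ (ends e) , ∈-select⁺ (covered? X) (e , e∈X , inj₁ refl))

  candidate-below : ∀ X → Nonempty X → ∣ cover X ∣ + k ≤ ∣ X ∣ →
                    ∃[ C ] Candidate C × C ⊆ X
  candidate-below X ne le = go X ne le (<-wellFounded ∣ X ∣)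
    where
    go : ∀ X → Nonempty X → ∣ cover X ∣ + k ≤ ∣ X ∣ → Acc _<_ ∣ X ∣ →
         ∃[ C ] Candidate C × C ⊆ X
    go X ne le (acc rs) with ∣ X ∣ ≟ ∣ cover X ∣ + k
    ... | yes eq = X , (ne , eq) , ⊆-refl
    ... | no  ne≢ with ne
    ...   | x , x∈X = C , cC , ⊆-trans C⊆ X-x⊆X
      where
      X-x⊆X : X - x ⊆ X
      X-x⊆X = p─q⊆p X ⁅ x ⁆
      big : ∣ cover X ∣ + k ≤ ∣ X - x ∣
      big = s≤s⁻¹ (≤-trans (≤∧≢⇒< le (ne≢ ∘ sym)) (∣p∣≤1+∣p-x∣ X x))
      ih = go (X - x)
        (0<⇒nonempty (≤-trans (0<cover ne) (≤-trans (m≤m+n _ k) big)))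
        (≤-trans (+-monoˡ-≤ k (p⊆q⇒∣p∣≤∣q∣ (cover-mono X-x⊆X))) big)
        (rs (x∈p⇒∣p-x∣<∣p∣ x∈X))
      C  = proj₁ ih
      cC = proj₁ (proj₂ ih)
      C⊆ = proj₂ (proj₂ ih)

  circuit-below : ∀ X → Nonempty X → ∣ cover X ∣ + k ≤ ∣ X ∣ →
                  ∃[ C ] Minimal Candidate C × C ⊆ X
  circuit-below X ne le with candidate-below X ne le
  ... | Y , cY , Y⊆X with minimal-below candidate? Y cY
  ...   | C , mC , C⊆Y = C , mC , ⊆-trans C⊆Y Y⊆X

  eliminate : ∀ C D e → Minimal Candidate C → Minimal Candidate D → C ≢ D →
              e ∈ C → e ∈ D → ∃[ F ] Minimal Candidate F × F ⊆ (C ∪ D) - e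
  eliminate C D e mC@((_ , ∣C∣) , minC) mD@((_ , ∣D∣) , minD) C≢D e∈C e∈D =
    circuit-below U (0<⇒nonempty 0<U) U-big
    where
    open ≤-Reasoning
    I U : EdgeSet
    I = C ∩ D
    U = (C ∪ D) - e

    I-small : ∣ I ∣ < ∣ cover I ∣ + k
    I-small = ≰⇒> λ le →
      let (Y , cY , Y⊆I) = candidate-below I (e , x∈p∩q⁺ (e∈C , e∈D)) le
          Y⊆C = ⊆-trans Y⊆I (p∩q⊆p C D)
          Y⊆D = ⊆-trans Y⊆I (p∩q⊆q C D)
      in C≢D (trans (sym (minC Y cY Y⊆C)) (minD Y cY Y⊆D))

    c∪ = ∣ cover (C ∪ D) ∣
    c∩ = ∣ cover I ∣

    union-big : suc (c∪ + k) ≤ ∣ C ∪ D ∣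
    union-big = +-cancelʳ-< (c∩ + k) (c∪ + k) ∣ C ∪ D ∣ (begin-strict
      (c∪ + k) + (c∩ + k)                  ≡⟨ interchange c∪ k c∩ k ⟩
      (c∪ + c∩) + (k + k)                  ≤⟨ +-monoˡ-≤ (k + k) (cover-submodular C D) ⟩
      (∣ cover C ∣ + ∣ cover D ∣) + (k + k) ≡⟨ interchange ∣ cover C ∣ ∣ cover D ∣ k k ⟩
      (∣ cover C ∣ + k) + (∣ cover D ∣ + k) ≡⟨ cong₂ _+_ (sym ∣C∣) (sym ∣D∣) ⟩
      ∣ C ∣ + ∣ D ∣                        ≡⟨ sym (∣∪∣+∣∩∣ C D) ⟩
      ∣ C ∪ D ∣ + ∣ I ∣                    <⟨ +-monoʳ-< ∣ C ∪ D ∣ I-small ⟩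
      ∣ C ∪ D ∣ + (c∩ + k)                 ∎)
      where
      open import Algebra.Properties.CommutativeSemigroup +-commutativeSemigroup
        using (interchange)

    U-big′ : c∪ + k ≤ ∣ U ∣
    U-big′ = s≤s⁻¹ (≤-trans union-big (∣p∣≤1+∣p-x∣ (C ∪ D) e))

    U-big : ∣ cover U ∣ + k ≤ ∣ U ∣
    U-big = ≤-trans
      (+-monoˡ-≤ k (p⊆q⇒∣p∣≤∣q∣ (cover-mono (p─q⊆p (C ∪ D) ⁅ e ⁆)))) U-big′

    0<U : 0 < ∣ U ∣
    0<U = ≤-trans (0<cover (e , x∈p∪q⁺ (inj₁ e∈C))) (≤-trans (m≤m+n _ k) U-big′)

  M : Matroid size
  M = record
    { Circuit     = Minimal Candidate
    ; nonempty    = λ C mC → proj₁ (proj₁ mC)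
    ; antichain   = λ C D mC mD C⊆D → proj₂ mD C (proj₁ mC) C⊆D
    ; elimination = eliminate
    }

-- Since A has a single cycle and e lies on it, A ∖ e is a tree, so every
-- set X of edges of A avoiding e satisfies |X| + 1 ≤ |W| for any nonempty
-- vertex set W covering X.  Let u ∉ B and let D be a circuit inside B + u.
-- If u touches A but e ∉ D, or if u misses A but e ∈ D, the bound shows that
-- the part of D on A (together with u in the first case) has no more edges
-- than D has vertices in A.  Discarding that part leaves an edge set that is
-- still large enough to contain a circuit, nonempty because k ≥ 1; this
-- circuit lies in B, respectively is properly contained in D.  Hence e ∈ D
-- exactly when u touches A, and K(e, B) consists of e and the u ∉ B whose
-- fundamental circuit contains e.
--
-- An edge of the kernel off the cycle would be a bridge of the kernel with an
-- acyclic side; that side is inhabited, as its end of the bridge is not a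
-- leaf, but a nonempty forest has a second leaf.

module Submission where

open import Defs
open import Data.Empty using (⊥; ⊥-elim)
open import Data.Fin.Base using (Fin)
open import Data.Fin.Properties using (any?) renaming (_≟_ to _≟F_)
open import Data.Fin.Subset hiding (⊥)
open import Data.Fin.Subset.Properties
import Data.List.Base as List
open import Data.List.Membership.Propositional using () renaming (_∈_ to _∈ₗ_)
open import Data.List.Relation.Unary.All as All using ()
open import Data.List.Relation.Unary.AllPairs using ([]; _∷_)
open import Data.List.Relation.Unary.Any as Any using ()
open import Data.List.Relation.Unary.Unique.Propositional using (Unique)
open import Data.Nat.Base using (ℕ; suc; _+_; _≤_; _<_; s≤s)
open import Data.Nat.Induction using (<-wellFounded)
open import Data.Nat.Properties
open import Data.Product.Base using (Σ-syntax; ∃-syntax; _×_; _,_; proj₁; proj₂; uncurry)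
open import Data.Sum.Base using (_⊎_; inj₁; inj₂; [_,_]; map₂; swap)
import Data.Unit.Base as Unit
open import Data.Vec.Base using ([]; _∷_; here; there)
open import Function.Base using (_∘_; id)
open import Function.Bundles using (_⇔_; mk⇔)
open import Induction.WellFounded using (Acc; acc)
open import Relation.Binary.Construct.Closure.ReflexiveTransitive as Star
  using (Star; ε; _◅_; _◅◅_)
open import Relation.Binary.PropositionalEquality hiding ([_])
open import Relation.Nullary using (¬_; yes; no)
open import Relation.Nullary.Decidable using (_×-dec_; _⊎-dec_; ¬?)
open import Relation.Unary using (Decidable)

-- Finite subsets

x∈p─q⇒x∉q : ∀ {n} {x : Fin n} p q → x ∈ p ─ q → x ∉ q
x∈p─q⇒x∉q (_ ∷ p) (outside ∷ q) (there x∈) (there x∈q) = x∈p─q⇒x∉q p q x∈ x∈q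
x∈p─q⇒x∉q (_ ∷ p) (inside  ∷ q) (there x∈) (there x∈q) = x∈p─q⇒x∉q p q x∈ x∈q

module _ {n : ℕ} where

  x∈p─q⁻ : ∀ {x : Fin n} p q → x ∈ p ─ q → x ∈ p × x ∉ q
  x∈p─q⁻ p q x∈ = p─q⊆p p q x∈ , x∈p─q⇒x∉q p q x∈

  x∈p-y⁻ : ∀ {x : Fin n} p y → x ∈ p - y → x ∈ p × x ≢ y
  x∈p-y⁻ p y x∈ with x∈p─q⁻ p ⁅ y ⁆ x∈
  ... | x∈p , x∉y = x∈p , x∉⁅y⁆⇒x≢y x∉y

  x∈p∪⁅y⁆⁻ : ∀ {x : Fin n} p y → x ∈ p ∪ ⁅ y ⁆ → x ∈ p ⊎ x ≡ y
  x∈p∪⁅y⁆⁻ p y x∈ = map₂ (x∈⁅y⁆⇒x≡y y) (x∈p∪q⁻ p ⁅ y ⁆ x∈)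

  y∈p∪⁅y⁆ : ∀ (p : Subset n) y → y ∈ p ∪ ⁅ y ⁆
  y∈p∪⁅y⁆ p y = x∈p∪q⁺ (inj₂ (x∈⁅x⁆ y))

  p∪q⊆r : ∀ {p q r : Subset n} → p ⊆ r → q ⊆ r → p ∪ q ⊆ r
  p∪q⊆r {p} {q} p⊆r q⊆r x∈ = [ p⊆r , q⊆r ] (x∈p∪q⁻ p q x∈)

  ⁅x⁆⊆p : ∀ {x : Fin n} {p} → x ∈ p → ⁅ x ⁆ ⊆ p
  ⁅x⁆⊆p {x} x∈p y∈ rewrite x∈⁅y⁆⇒x≡y x y∈ = x∈p

  p⊆q∪⁅x⁆∧x∉p⇒p⊆q : ∀ {p q : Subset n} {x} → p ⊆ q ∪ ⁅ x ⁆ → x ∉ p → p ⊆ q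
  p⊆q∪⁅x⁆∧x∉p⇒p⊆q {p} {q} {x} p⊆ x∉p y∈p with x∈p∪⁅y⁆⁻ q x (p⊆ y∈p)
  ... | inj₁ y∈q  = y∈q
  ... | inj₂ refl = ⊥-elim (x∉p y∈p)

  ⊆⊎witness : ∀ (p q : Subset n) → p ⊆ q ⊎ ∃[ x ] x ∈ p × x ∉ q
  ⊆⊎witness p q with any? (λ x → (x ∈? p) ×-dec ¬? (x ∈? q))
  ... | yes w = inj₂ w
  ... | no ¬w = inj₁ p⊆q
    where
    p⊆q : p ⊆ q
    p⊆q {x} x∈p with x ∈? q
    ... | yes x∈q = x∈q
    ... | no  x∉q = ⊥-elim (¬w (x , x∈p , x∉q))

∣p∣≡∣p∩q∣+∣p─q∣ : ∀ {n} (p q : Subset n) → ∣ p ∣ ≡ ∣ p ∩ q ∣ + ∣ p ─ q ∣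
∣p∣≡∣p∩q∣+∣p─q∣ []            []            = refl
∣p∣≡∣p∩q∣+∣p─q∣ (outside ∷ p) (outside ∷ q) = ∣p∣≡∣p∩q∣+∣p─q∣ p q
∣p∣≡∣p∩q∣+∣p─q∣ (outside ∷ p) (inside  ∷ q) = ∣p∣≡∣p∩q∣+∣p─q∣ p q
∣p∣≡∣p∩q∣+∣p─q∣ (inside  ∷ p) (inside  ∷ q) = cong suc (∣p∣≡∣p∩q∣+∣p─q∣ p q)
∣p∣≡∣p∩q∣+∣p─q∣ (inside  ∷ p) (outside ∷ q) =
  trans (cong suc (∣p∣≡∣p∩q∣+∣p─q∣ p q)) (sym (+-suc ∣ p ∩ q ∣ ∣ p ─ q ∣))

-- Matroids: circuit elimination, base exchange, fundamental cocircuits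

module _ {m : ℕ} (M : Matroid m) where
  open Matroid M

  -- Induction on the size of `C ∪ D`. If plain elimination yields an `F` without `f`, then `F` has
  -- an element `g` of `D` outside `C`. Two smaller eliminations repair this: `D` against `F` at `g`
  -- keeping `e`, then `C` against the result at `e` keeping `f`.
  strong-elimination : ∀ {C D e f} → Circuit C → Circuit D → e ∈ C → e ∈ D →
                       f ∈ C → f ∉ D → ∃[ F ] Circuit F × f ∈ F × F ⊆ (C ∪ D) - e
  strong-elimination {C} {D} = go (<-wellFounded ∣ C ∪ D ∣)
    where
    go : ∀ {C D e f} → Acc _<_ ∣ C ∪ D ∣ → Circuit C → Circuit D → e ∈ C → e ∈ D →
         f ∈ C → f ∉ D → ∃[ F ] Circuit F × f ∈ F × F ⊆ (C ∪ D) - e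
    go {C} {D} {e} {f} (acc rs) cC cD e∈C e∈D f∈C f∉D
      with elimination C D e cC cD (λ C≡D → f∉D (subst (f ∈_) C≡D f∈C)) e∈C e∈D
    ... | F , cF , F⊆ with f ∈? F
    ...   | yes f∈F = F , cF , f∈F , F⊆
    ...   | no  f∉F with ⊆⊎witness F C
    ...     | inj₁ F⊆C = ⊥-elim (f∉F (subst (f ∈_) (sym (antichain F C cF cC F⊆C)) f∈C))
    ...     | inj₂ (g , g∈F , g∉C) = F″ , cF″ , f∈F″ , F″⊆
      where
      F⊆C∪D : F ⊆ C ∪ D
      F⊆C∪D = p─q⊆p (C ∪ D) ⁅ e ⁆ ∘ F⊆

      g∈D : g ∈ D
      g∈D = [ ⊥-elim ∘ g∉C , id ] (x∈p∪q⁻ C D (F⊆C∪D g∈F))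

      D∪F⊆C∪D : D ∪ F ⊆ C ∪ D
      D∪F⊆C∪D = p∪q⊆r (q⊆p∪q C D) F⊆C∪D

      f∉D∪F : f ∉ D ∪ F
      f∉D∪F f∈ = [ f∉D , f∉F ] (x∈p∪q⁻ D F f∈)

      -- Smaller instance: `f` lies in `C` but not in `D ∪ F`.
      toward-e = go (rs (p⊂q⇒∣p∣<∣q∣ (D∪F⊆C∪D , f , x∈p∪q⁺ (inj₁ f∈C) , f∉D∪F)))
        cD cF g∈D g∈F e∈D (λ e∈F → proj₂ (x∈p-y⁻ (C ∪ D) e (F⊆ e∈F)) refl)
      F′   = proj₁ toward-e
      cF′  = proj₁ (proj₂ toward-e)
      e∈F′ = proj₁ (proj₂ (proj₂ toward-e))

      F′⊆ : F′ ⊆ (D ∪ F) - g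
      F′⊆ = proj₂ (proj₂ (proj₂ toward-e))

      F′⊆D∪F : F′ ⊆ D ∪ F
      F′⊆D∪F = p─q⊆p (D ∪ F) ⁅ g ⁆ ∘ F′⊆

      C∪F′⊆C∪D : C ∪ F′ ⊆ C ∪ D
      C∪F′⊆C∪D = p∪q⊆r (p⊆p∪q D) (D∪F⊆C∪D ∘ F′⊆D∪F)

      g∉C∪F′ : g ∉ C ∪ F′
      g∉C∪F′ g∈ =
        [ g∉C , (λ g∈F′ → proj₂ (x∈p-y⁻ (D ∪ F) g (F′⊆ g∈F′)) refl) ] (x∈p∪q⁻ C F′ g∈)

      -- Smaller instance: `g` was eliminated from `F′` and does not lie in `C`.
      toward-f = go (rs (p⊂q⇒∣p∣<∣q∣ (C∪F′⊆C∪D , g , x∈p∪q⁺ (inj₂ g∈D) , g∉C∪F′)))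
        cC cF′ e∈C e∈F′ f∈C (f∉D∪F ∘ F′⊆D∪F)
      F″   = proj₁ toward-f
      cF″  = proj₁ (proj₂ toward-f)
      f∈F″ = proj₁ (proj₂ (proj₂ toward-f))

      F″⊆ : F″ ⊆ (C ∪ D) - e
      F″⊆ x∈ with x∈p-y⁻ (C ∪ F′) e (proj₂ (proj₂ (proj₂ toward-f)) x∈)
      ... | x∈C∪F′ , x≢e = x∈p∧x≢y⇒x∈p-y (C∪F′⊆C∪D x∈C∪F′) x≢e

  module _ (independent? : ∀ X → Independent X ⊎ ∃[ C ] Circuit C × C ⊆ X) where

    fundamental-circuit : ∀ {B u} → Base B → u ∉ B →
                          ∃[ C ] Circuit C × C ⊆ B ∪ ⁅ u ⁆ × u ∈ C
    fundamental-circuit {B} {u} (indep , max) u∉B with independent? (B ∪ ⁅ u ⁆)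
    ... | inj₁ indep′ =
      ⊥-elim (u∉B (subst (u ∈_) (max _ indep′ (p⊆p∪q ⁅ u ⁆)) (y∈p∪⁅y⁆ B u)))
    ... | inj₂ (C , cC , C⊆) with u ∈? C
    ...   | yes u∈C = C , cC , C⊆ , u∈C
    ...   | no  u∉C = ⊥-elim (indep C cC (p⊆q∪⁅x⁆∧x∉p⇒p⊆q C⊆ u∉C))

    -- The last two hypotheses speak of every circuit inside `B ∪ ⁅ u ⁆`, so uniqueness of
    -- fundamental circuits never has to be proved.
    module _ {B e K} (base : Base B) (e∈B : e ∈ B) (e∈K : e ∈ K)
      (K∩B⊆e : ∀ {u} → u ∈ K → u ∈ B → u ≡ e)
      (e∈circuit : ∀ {u C} → u ∈ K → u ∉ B → Circuit C → C ⊆ B ∪ ⁅ u ⁆ → e ∈ C)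
      (e∉circuit : ∀ {u C} → u ∉ K → u ∉ B → Circuit C → C ⊆ B ∪ ⁅ u ⁆ → e ∉ C)
      where

      -- A circuit inside `(B - e) ∪ ⁅ u ⁆` would lie in `B ∪ ⁅ u ⁆` and hence contain the removed
      -- `e`. For maximality, adding any `y` creates a circuit: that of `u` if `y` is `e`, otherwise
      -- that of `y`, rid of `e` if necessary.
      exchange : ∀ {u} → u ∈ K → u ∉ B → Base ((B - e) ∪ ⁅ u ⁆)
      exchange {u} u∈K u∉B = indep , max
        where
        B′ : Subset m
        B′ = (B - e) ∪ ⁅ u ⁆

        B′⊆ : B′ ⊆ B ∪ ⁅ u ⁆
        B′⊆ = p∪q⊆r (p⊆p∪q ⁅ u ⁆ ∘ p─q⊆p B ⁅ e ⁆) (q⊆p∪q B ⁅ u ⁆)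

        e∉B′ : e ∉ B′
        e∉B′ e∈ with x∈p∪⁅y⁆⁻ (B - e) u e∈
        ... | inj₁ e∈B-e = proj₂ (x∈p-y⁻ B e e∈B-e) refl
        ... | inj₂ refl  = u∉B e∈B

        indep : Independent B′
        indep C cC C⊆ = e∉B′ (C⊆ (e∈circuit u∈K u∉B cC (B′⊆ ∘ C⊆)))

        B⊆B′∪e : ∀ {x} → x ∈ B → x ≢ e → x ∈ B′
        B⊆B′∪e x∈B x≢e = x∈p∪q⁺ (inj₁ (x∈p∧x≢y⇒x∈p-y x∈B x≢e))

        max : ∀ Y → Independent Y → B′ ⊆ Y → Y ≡ B′
        max Y indepY B′⊆Y with ⊆⊎witness Y B′
        ... | inj₁ Y⊆B′ = ⊆-antisym Y⊆B′ B′⊆Y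
        ... | inj₂ (y , y∈Y , y∉B′) with fundamental-circuit base u∉B
        ...   | C , cC , C⊆ , u∈C with y ≟F e
        ...     | yes refl = ⊥-elim (indepY C cC C⊆Y)
          where
          C⊆Y : C ⊆ Y
          C⊆Y {x} x∈C with x ≟F e
          ... | yes refl = y∈Y
          ... | no  x≢e with x∈p∪⁅y⁆⁻ B u (C⊆ x∈C)
          ...   | inj₁ x∈B  = B′⊆Y (B⊆B′∪e x∈B x≢e)
          ...   | inj₂ refl = B′⊆Y (y∈p∪⁅y⁆ (B - e) u)
        ...     | no  y≢e with fundamental-circuit base (λ y∈B → y∉B′ (B⊆B′∪e y∈B y≢e))
        ...       | D , cD , D⊆ , y∈D = ⊥-elim contra
          where
          D-e⊆Y : ∀ {x} → x ∈ D → x ≢ e → x ∈ Y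
          D-e⊆Y x∈D x≢e with x∈p∪⁅y⁆⁻ B y (D⊆ x∈D)
          ... | inj₁ x∈B  = B′⊆Y (B⊆B′∪e x∈B x≢e)
          ... | inj₂ refl = y∈Y

          C-e⊆Y : ∀ {x} → x ∈ C → x ≢ e → x ∈ Y
          C-e⊆Y x∈C x≢e with x∈p∪⁅y⁆⁻ B u (C⊆ x∈C)
          ... | inj₁ x∈B  = B′⊆Y (B⊆B′∪e x∈B x≢e)
          ... | inj₂ refl = B′⊆Y (y∈p∪⁅y⁆ (B - e) u)

          y∉C : y ∉ C
          y∉C y∈C with x∈p∪⁅y⁆⁻ B u (C⊆ y∈C)
          ... | inj₁ y∈B  = y∉B′ (B⊆B′∪e y∈B y≢e)
          ... | inj₂ refl = y∉B′ (y∈p∪⁅y⁆ (B - e) u)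

          contra : ⊥
          contra with e ∈? D
          ... | no  e∉D = indepY D cD (λ {x} x∈D → D-e⊆Y x∈D (λ { refl → e∉D x∈D }))
          -- The fundamental circuits of `u` and `y` share `e` and differ in `y`; eliminating `e`
          -- leaves a circuit inside `Y`.
          ... | yes e∈D
            with elimination C D e cC cD (λ C≡D → y∉C (subst (y ∈_) (sym C≡D) y∈D))
                   (e∈circuit u∈K u∉B cC C⊆) e∈D
          ...   | F , cF , F⊆ = indepY F cF F⊆Y
            where
            F⊆Y : F ⊆ Y
            F⊆Y x∈F with x∈p-y⁻ (C ∪ D) e (F⊆ x∈F)
            ... | x∈ , x≢e with x∈p∪q⁻ C D x∈
            ...   | inj₁ x∈C = C-e⊆Y x∈C x≢e
            ...   | inj₂ x∈D = D-e⊆Y x∈D x≢e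

      -- A base missing K would give a circuit meeting K in e alone;
      -- eliminating its elements outside B one at a time keeps e and ends
      -- with a circuit inside B.
      ¬coindependent : ¬ Coindependent K
      ¬coindependent (B′ , base′ , K⊆∁B′)
        with fundamental-circuit base′ (x∈∁p⇒x∉p (K⊆∁B′ e∈K))
      ... | D₀ , cD₀ , D₀⊆ , e∈D₀ = descend D₀ cD₀ e∈D₀ D₀∩K (<-wellFounded _)
        where
        D₀∩K : ∀ {x} → x ∈ D₀ → x ∈ K → x ≡ e
        D₀∩K x∈D₀ x∈K with x∈p∪⁅y⁆⁻ B′ e (D₀⊆ x∈D₀)
        ... | inj₁ x∈B′ = ⊥-elim (x∈∁p⇒x∉p (K⊆∁B′ x∈K) x∈B′)
        ... | inj₂ x≡e  = x≡e

        descend : ∀ D → Circuit D → e ∈ D → (∀ {x} → x ∈ D → x ∈ K → x ≡ e) →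
                  Acc _<_ ∣ D ─ B ∣ → ⊥
        descend D cD e∈D D∩K (acc rs) with ⊆⊎witness D B
        ... | inj₁ D⊆B = proj₁ base D cD D⊆B
        ... | inj₂ (u , u∈D , u∉B) with fundamental-circuit base u∉B
        ...   | C , cC , C⊆ , u∈C
          with strong-elimination cD cC u∈D u∈C e∈D
                 (e∉circuit (λ u∈K → u∉B (subst (_∈ B) (sym (D∩K u∈D u∈K)) e∈B)) u∉B cC C⊆)
        ...     | F , cF , e∈F , F⊆ =
          descend F cF e∈F F∩K (rs (p⊂q⇒∣p∣<∣q∣ (smaller , u , u∈D─B , u∉F─B)))
          where
          from : ∀ {x} → x ∈ F → x ∈ D ⊎ x ∈ B
          from x∈F with x∈p-y⁻ (D ∪ C) u (F⊆ x∈F)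
          ... | x∈ , x≢u with x∈p∪q⁻ D C x∈
          ...   | inj₁ x∈D = inj₁ x∈D
          ...   | inj₂ x∈C = inj₂ ([ id , ⊥-elim ∘ x≢u ] (x∈p∪⁅y⁆⁻ B u (C⊆ x∈C)))

          F∩K : ∀ {x} → x ∈ F → x ∈ K → x ≡ e
          F∩K x∈F x∈K = [ (λ x∈D → D∩K x∈D x∈K) , K∩B⊆e x∈K ] (from x∈F)

          smaller : F ─ B ⊆ D ─ B
          smaller x∈ with x∈p─q⁻ F B x∈
          ... | x∈F , x∉B = x∈p∧x∉q⇒x∈p─q ([ id , ⊥-elim ∘ x∉B ] (from x∈F)) x∉B

          u∈D─B : u ∈ D ─ B
          u∈D─B = x∈p∧x∉q⇒x∈p─q u∈D u∉B

          u∉F─B : u ∉ F ─ B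
          u∉F─B u∈ = proj₂ (x∈p-y⁻ (D ∪ C) u (F⊆ (proj₁ (x∈p─q⁻ F B u∈)))) refl

      fundamental-cocircuit : FundamentalCocircuit B e K
      fundamental-cocircuit = ((¬coindependent , minimal) , K∩B≡e) , unique
        where
        K∩B≡e : K ∩ B ≡ ⁅ e ⁆
        K∩B≡e = ⊆-antisym
          (λ x∈ → let (x∈K , x∈B) = x∈p∩q⁻ K B x∈ in
             subst (_∈ ⁅ e ⁆) (sym (K∩B⊆e x∈K x∈B)) (x∈⁅x⁆ e))
          (⁅x⁆⊆p (x∈p∩q⁺ (e∈K , e∈B)))

        -- The base avoiding `K′` is `B` itself if `x` is `e`, and the exchanged base
        -- `(B - e) ∪ ⁅ x ⁆` otherwise.
        misses : ∀ {K′ x} → (∀ {y} → y ∈ K′ → y ∈ B → y ≡ e) → x ∈ K → x ∉ K′ →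
                 (x ≡ e ⊎ x ∉ B) → Coindependent K′
        misses {K′} K′∩B x∈K x∉K′ (inj₁ refl) = B , base ,
          λ y∈K′ → x∉p⇒x∈∁p (λ y∈B → x∉K′ (subst (_∈ K′) (K′∩B y∈K′ y∈B) y∈K′))
        misses {K′} {x} K′∩B x∈K x∉K′ (inj₂ x∉B) = _ , exchange x∈K x∉B ,
          λ {y} y∈K′ → x∉p⇒x∈∁p (λ y∈B′ →
            [ (λ y∈B-e → let (y∈B , y≢e) = x∈p-y⁻ B e y∈B-e in y≢e (K′∩B y∈K′ y∈B))
            , (λ { refl → x∉K′ y∈K′ })
            ] (x∈p∪⁅y⁆⁻ (B - e) x y∈B′))

        e-or-∉B : ∀ {x} → x ∈ K → x ≡ e ⊎ x ∉ B
        e-or-∉B {x} x∈K with x ∈? B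
        ... | yes x∈B = inj₁ (K∩B⊆e x∈K x∈B)
        ... | no  x∉B = inj₂ x∉B

        -- This gives minimality directly, and uniqueness through the minimality of the competing
        -- cocircuit.
        K⊆ : ∀ {K′} → ¬ Coindependent K′ → (∀ {y} → y ∈ K′ → y ∈ B → y ≡ e) → K ⊆ K′
        K⊆ {K′} ¬co K′∩B {x} x∈K with x ∈? K′
        ... | yes x∈K′ = x∈K′
        ... | no  x∉K′ = ⊥-elim (¬co (misses K′∩B x∈K x∉K′ (e-or-∉B x∈K)))

        minimal : ∀ Y → ¬ Coindependent Y → Y ⊆ K → Y ≡ K
        minimal Y ¬co Y⊆K = ⊆-antisym Y⊆K (K⊆ ¬co (K∩B⊆e ∘ Y⊆K))

        unique : ∀ K′ → Cocircuit K′ → K′ ∩ B ≡ ⁅ e ⁆ → K′ ≡ K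
        unique K′ (¬co , min) K′∩B≡e = sym (min K ¬coindependent (K⊆ ¬co
          (λ y∈K′ y∈B → x∈⁅y⁆⇒x≡y e (subst (_ ∈_) K′∩B≡e (x∈p∩q⁺ (y∈K′ , y∈B))))))

-- Graphs: incidence, walks and cycles

module _ {G : Graph} where
  open Graph G

  joins-sym : ∀ {f u v} → Joins f u v → Joins f v u
  joins-sym = swap

  joins-left : ∀ {f u v} → Joins f u v → Incident f u
  joins-left (inj₁ eq) = inj₁ (cong proj₁ eq)
  joins-left (inj₂ eq) = inj₂ (cong proj₂ eq)

  joins-right : ∀ {f u v} → Joins f u v → Incident f v
  joins-right = joins-left ∘ joins-sym

  joins-ends : ∀ f → Joins f (proj₁ (ends f)) (proj₂ (ends f))
  joins-ends f = inj₁ refl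

  incident⇒joins : ∀ {f v} → Incident f v → ∃[ w ] Joins f v w
  incident⇒joins {f} (inj₁ refl) = _ , joins-ends f
  incident⇒joins {f} (inj₂ refl) = _ , joins-sym (joins-ends f)

  incident-ends : ∀ {f u v w} → Joins f u v → Incident f w → w ≡ u ⊎ w ≡ v
  incident-ends (inj₁ eq) (inj₁ refl) = inj₁ (cong proj₁ eq)
  incident-ends (inj₁ eq) (inj₂ refl) = inj₂ (cong proj₂ eq)
  incident-ends (inj₂ eq) (inj₁ refl) = inj₂ (cong proj₁ eq)
  incident-ends (inj₂ eq) (inj₂ refl) = inj₁ (cong proj₂ eq)

  joins-unique : ∀ {f u v x y} → Joins f u v → Joins f x y →
                 (u ≡ x × v ≡ y) ⊎ (u ≡ y × v ≡ x)
  joins-unique (inj₁ p) (inj₁ q) with trans (sym p) q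
  ... | refl = inj₁ (refl , refl)
  joins-unique (inj₁ p) (inj₂ q) with trans (sym p) q
  ... | refl = inj₂ (refl , refl)
  joins-unique (inj₂ p) (inj₁ q) with trans (sym p) q
  ... | refl = inj₂ (refl , refl)
  joins-unique (inj₂ p) (inj₂ q) with trans (sym p) q
  ... | refl = inj₁ (refl , refl)

  loop⇒≡ : ∀ {f u v} → Joins f u v → Loop f → u ≡ v
  loop⇒≡ (inj₁ refl) l = l
  loop⇒≡ (inj₂ refl) l = sym l

  -- Chains of links record only which edges may be used, not the host subgraph, so they can be
  -- reversed, concatenated and moved to a larger edge set freely.
  Linked : EdgeSet → Vertex → Vertex → Set
  Linked X u v = ∃[ f ] f ∈ X × Joins f u v

  linked-mono : ∀ {X Y u v} → X ⊆ Y → Star (Linked X) u v → Star (Linked Y) u v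
  linked-mono X⊆Y = Star.map (λ { (f , f∈X , j) → f , X⊆Y f∈X , j })

  linked-sym : ∀ {X u v} → Star (Linked X) u v → Star (Linked X) v u
  linked-sym = Star.reverse (λ { (f , f∈X , j) → f , f∈X , joins-sym j })

  start∈ : ∀ {H : Subgraph G} {u v} (P : Walk H u v) → u ∈ₗ vertices P
  start∈ (stop _)       = Any.here refl
  start∈ (step _ _ _ _) = Any.here refl

  edge-end∈ : ∀ {H : Subgraph G} {u v} (P : Walk H u v) {f w} →
              f ∈ edges P → Incident f w → w ∈ₗ vertices P
  edge-end∈ (stop _) f∈ _ = ⊥-elim (∉⊥ f∈)
  edge-end∈ (step g _ j P) f∈ i with x∈p∪q⁻ ⁅ g ⁆ (edges P) f∈
  ... | inj₂ f∈P = Any.there (edge-end∈ P f∈P i)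
  ... | inj₁ f∈g with x∈⁅y⁆⇒x≡y g f∈g
  ...   | refl with incident-ends j i
  ...     | inj₁ refl = Any.here refl
  ...     | inj₂ refl = Any.there (start∈ P)

  edges⊆ : ∀ {H : Subgraph G} {u v} (P : Walk H u v) → edges P ⊆ E H
  edges⊆ (stop _)         = ⊥-elim ∘ ∉⊥
  edges⊆ (step f f∈H _ P) = p∪q⊆r (⁅x⁆⊆p f∈H) (edges⊆ P)

  walk⇒linked : ∀ {H : Subgraph G} {u v} (P : Walk H u v) → Star (Linked (edges P)) u v
  walk⇒linked (stop _)       = ε
  walk⇒linked (step f _ j P) =
    (f , x∈p∪q⁺ (inj₁ (x∈⁅x⁆ f)) , j) ◅ linked-mono (q⊆p∪q ⁅ f ⁆ (edges P)) (walk⇒linked P)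

  linked⇒walk : ∀ (H : Subgraph G) {X u v} → X ⊆ E H → u ∈ V H →
                Star (Linked X) u v → Walk H u v
  linked⇒walk H X⊆H u∈H ε                    = stop u∈H
  linked⇒walk H X⊆H u∈H ((f , f∈X , j) ◅ Ls) = step f (X⊆H f∈X) j
    (linked⇒walk H X⊆H (Subgraph.closed H f _ (X⊆H f∈X) (joins-right j)) Ls)

  cycle⊆ : ∀ {H : Subgraph G} {C} → Cycle H C → C ⊆ E H
  cycle⊆ (_ , _ , P , f , _ , f∈H , _ , _ , refl) = p∪q⊆r (⁅x⁆⊆p f∈H) (edges⊆ P)

  cycle-nonempty : ∀ {H : Subgraph G} {C} → Cycle H C → Nonempty C
  cycle-nonempty (_ , _ , _ , f , _ , _ , _ , _ , refl) = f , x∈p∪q⁺ (inj₁ (x∈⁅x⁆ f))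

  split-path : ∀ {H : Subgraph G} {u v e} (P : Walk H u v) → Unique (vertices P) → e ∈ edges P →
               ∃[ x ] ∃[ y ] Joins e x y × Star (Linked (edges P - e)) u x ×
                             Star (Linked (edges P - e)) y v
  split-path (stop _) _ e∈ = ⊥-elim (∉⊥ e∈)
  split-path {e = e} (step f _ j P) (u∉P ∷ uniq) e∈ with e ≟F f
  ... | yes refl = _ , _ , j , ε , linked-mono P⊆ (walk⇒linked P)
    where
    P⊆ : edges P ⊆ (⁅ f ⁆ ∪ edges P) - f
    P⊆ g∈P = x∈p∧x≢y⇒x∈p-y (x∈p∪q⁺ (inj₂ g∈P))
      -- Using `f` a second time would bring the path back to its first vertex.
      (λ { refl → All.lookup u∉P (edge-end∈ P g∈P (joins-left j)) refl })
  ... | no e≢f with split-path P uniq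
                      ([ ⊥-elim ∘ e≢f ∘ x∈⁅y⁆⇒x≡y f , id ] (x∈p∪q⁻ ⁅ f ⁆ (edges P) e∈))
  ...   | x , y , je , L₁ , L₂ = x , y , je ,
    ((f , x∈p∧x≢y⇒x∈p-y (x∈p∪q⁺ (inj₁ (x∈⁅x⁆ f))) (e≢f ∘ sym) , j) ◅ linked-mono P⊆ L₁) ,
    linked-mono P⊆ L₂
    where
    P⊆ : edges P - e ⊆ (⁅ f ⁆ ∪ edges P) - e
    P⊆ g∈ with x∈p-y⁻ (edges P) e g∈
    ... | g∈P , g≢e = x∈p∧x≢y⇒x∈p-y (x∈p∪q⁺ (inj₂ g∈P)) g≢e

  -- If `e` closes the cycle, the path itself is the detour. Otherwise `e` splits the path, and the
  -- detour runs back along the first piece, over the closing edge, and back along the second.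
  cycle-detour : ∀ {H : Subgraph G} {C e x y} → Cycle H C → e ∈ C → Joins e x y →
                 Star (Linked (C - e)) x y
  cycle-detour {H} {C} {e} cyc e∈C j with unoriented cyc
    where
    unoriented : Cycle H C → ∃[ x ] ∃[ y ] Joins e x y × Star (Linked (C - e)) x y
    unoriented (u , v , P , f , uniq , _ , jf , f∉P , refl) with e ≟F f
    ... | yes refl = u , v , jf , linked-mono
      (λ g∈P → x∈p∧x≢y⇒x∈p-y (x∈p∪q⁺ (inj₂ g∈P)) (λ { refl → f∉P g∈P })) (walk⇒linked P)
    ... | no e≢f with split-path P uniq
                        ([ ⊥-elim ∘ e≢f ∘ x∈⁅y⁆⇒x≡y f , id ] (x∈p∪q⁻ ⁅ f ⁆ (edges P) e∈C))
    ...   | x , y , je , L₁ , L₂ = x , y , je ,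
      (linked-sym (linked-mono P⊆ L₁) ◅◅
       ((f , x∈p∧x≢y⇒x∈p-y (x∈p∪q⁺ (inj₁ (x∈⁅x⁆ f))) (e≢f ∘ sym) , jf) ◅
        linked-sym (linked-mono P⊆ L₂)))
      where
      P⊆ : edges P - e ⊆ (⁅ f ⁆ ∪ edges P) - e
      P⊆ g∈ with x∈p-y⁻ (edges P) e g∈
      ... | g∈P , g≢e = x∈p∧x≢y⇒x∈p-y (x∈p∪q⁺ (inj₂ g∈P)) g≢e
  ... | x , y , je , L with joins-unique je j
  ...   | inj₁ (refl , refl) = L
  ...   | inj₂ (refl , refl) = linked-sym L

  -- The ends of `e` differ, so the detour around the cycle is not empty, and its first edge leaves
  -- `v`.
  cycle-leafless : ∀ {H : Subgraph G} {C e v} → Cycle H C → e ∈ C → Incident e v → ¬ Loop e →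
                   ∃[ g ] g ∈ C × g ≢ e × Incident g v
  cycle-leafless {C = C} {e} cyc e∈C i ¬loop with incident⇒joins i
  ... | w , j with cycle-detour cyc e∈C j
  ...   | ε = ⊥-elim (¬loop (ends-equal j))
    where
    ends-equal : ∀ {v} → Joins e v v → Loop e
    ends-equal (inj₁ eq) = trans (cong proj₁ eq) (sym (cong proj₂ eq))
    ends-equal (inj₂ eq) = trans (cong proj₁ eq) (sym (cong proj₂ eq))
  ...   | (g , g∈ , jg) ◅ _ with x∈p-y⁻ C e g∈
  ...     | g∈C , g≢e = g , g∈C , g≢e , joins-left jg

  -- Closed vertex sets, reachability and cuts

  Closed : EdgeSet → VertexSet → Set
  Closed Y S = ∀ {g v w} → g ∈ Y → Joins g v w → v ∈ S → w ∈ S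

  closed-∁ : ∀ {Y S} → Closed Y S → Closed Y (∁ S)
  closed-∁ cl g∈Y j v∉S = x∉p⇒x∈∁p (x∈∁p⇒x∉p v∉S ∘ cl g∈Y (joins-sym j))

  closed? : ∀ Y S → Closed Y S ⊎ ∃[ g ] ∃[ s ] ∃[ t ] g ∈ Y × Joins g t s × s ∈ S × t ∉ S
  closed? Y S with any? (λ g → (g ∈? Y) ×-dec
    (((proj₁ (ends g) ∈? S) ×-dec ¬? (proj₂ (ends g) ∈? S)) ⊎-dec
     ((proj₂ (ends g) ∈? S) ×-dec ¬? (proj₁ (ends g) ∈? S))))
  ... | yes (g , g∈Y , inj₁ (s∈S , t∉S)) =
    inj₂ (g , _ , _ , g∈Y , joins-sym (joins-ends g) , s∈S , t∉S)
  ... | yes (g , g∈Y , inj₂ (s∈S , t∉S)) = inj₂ (g , _ , _ , g∈Y , joins-ends g , s∈S , t∉S)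
  ... | no none = inj₁ closed
    where
    closed : Closed Y S
    closed {g} {v} {w} g∈Y j v∈S with w ∈? S
    ... | yes w∈S = w∈S
    closed g∈Y (inj₁ refl) v∈S | no w∉S = ⊥-elim (none (_ , g∈Y , inj₁ (v∈S , w∉S)))
    closed g∈Y (inj₂ refl) v∈S | no w∉S = ⊥-elim (none (_ , g∈Y , inj₂ (v∈S , w∉S)))

  module _ (H : Subgraph G) where

    Path : EdgeSet → VertexSet → Vertex → Vertex → Set
    Path Y S u v = Σ[ P ∈ Walk H u v ]
      Unique (vertices P) × edges P ⊆ Y × (∀ {w} → w ∈ₗ vertices P → w ∈ S)

    -- Keeping the paths inside S makes them stay simple as S grows.
    reachable : ∀ {Y a} → Y ⊆ E H → a ∈ V H →
                ∃[ S ] a ∈ S × Closed Y S × (∀ {s} → s ∈ S → Path Y S s a)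
    reachable {Y} {a} Y⊆H a∈H = grow ⁅ a ⁆ (x∈⁅x⁆ a) single (<-wellFounded _)
      where
      single : ∀ {s} → s ∈ ⁅ a ⁆ → Path Y ⁅ a ⁆ s a
      single s∈ with x∈⁅y⁆⇒x≡y a s∈
      ... | refl = stop a∈H , All.[] ∷ [] , ⊥-elim ∘ ∉⊥ , λ { (Any.here refl) → s∈ }

      grow : ∀ S → a ∈ S → (∀ {s} → s ∈ S → Path Y S s a) → Acc _<_ ∣ ∁ S ∣ →
             ∃[ S ] a ∈ S × Closed Y S × (∀ {s} → s ∈ S → Path Y S s a)
      grow S a∈S paths (acc rs) with closed? Y S
      ... | inj₁ closed = S , a∈S , closed , paths
      ... | inj₂ (g , s , t , g∈Y , j , s∈S , t∉S) =
        grow (S ∪ ⁅ t ⁆) (S⊆ a∈S) paths′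
          (rs (p⊂q⇒∣p∣<∣q∣ (p⊂q⇒∁p⊃∁q (S⊆ , t , y∈p∪⁅y⁆ S t , t∉S))))
        where
        S⊆ : S ⊆ S ∪ ⁅ t ⁆
        S⊆ = p⊆p∪q ⁅ t ⁆

        paths′ : ∀ {r} → r ∈ S ∪ ⁅ t ⁆ → Path Y (S ∪ ⁅ t ⁆) r a
        paths′ {r} r∈ with x∈p∪⁅y⁆⁻ S t r∈
        ... | inj₁ r∈S with paths r∈S
        ...   | P , uniq , P⊆Y , P⊆S = P , uniq , P⊆Y , S⊆ ∘ P⊆S
        paths′ r∈ | inj₂ refl with paths s∈S
        ... | P , uniq , P⊆Y , P⊆S =
          step g (Y⊆H g∈Y) j P ,
          All.tabulate (λ { w∈P refl → t∉S (P⊆S w∈P) }) ∷ uniq ,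
          p∪q⊆r (⁅x⁆⊆p g∈Y) P⊆Y ,
          λ { (Any.here refl) → r∈ ; (Any.there w∈P) → S⊆ (P⊆S w∈P) }

    -- Cycles are those of the fixed `H`, tested by inclusion, so edge sets need not be turned into
    -- subgraphs.
    Acyclic : EdgeSet → Set
    Acyclic X = ∀ D → Cycle H D → ¬ (D ⊆ X)

    acyclic-⊆ : ∀ {X Y} → Y ⊆ X → Acyclic X → Acyclic Y
    acyclic-⊆ Y⊆X acyclic D cyc D⊆Y = acyclic D cyc (Y⊆X ∘ D⊆Y)

    -- Let `S` be what reaches `a` without `f`. If `b` is in `S`, a simple path from `b` to `a` is
    -- closed by `f` to a cycle; if not, `S` is the cut.
    cycle⊎cut : ∀ {X f a b} → X ⊆ E H → f ∈ X → Joins f a b →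
                (∃[ D ] Cycle H D × D ⊆ X × f ∈ D) ⊎
                (∃[ S ] a ∈ S × b ∉ S × Closed (X - f) S)
    cycle⊎cut {X} {f} {a} {b} X⊆H f∈X j
      with reachable (X⊆H ∘ p─q⊆p X ⁅ f ⁆) (Subgraph.closed H f a (X⊆H f∈X) (joins-left j))
    ... | S , a∈S , closed , paths with b ∈? S
    ...   | no  b∉S = inj₂ (S , a∈S , b∉S , closed)
    ...   | yes b∈S with paths b∈S
    ...     | P , uniq , P⊆ , _ = inj₁ (⁅ f ⁆ ∪ edges P ,
      (b , a , P , f , uniq , X⊆H f∈X , joins-sym j ,
        (λ f∈P → proj₂ (x∈p-y⁻ X f (P⊆ f∈P)) refl) , refl) ,
      p∪q⊆r (⁅x⁆⊆p f∈X) (p─q⊆p X ⁅ f ⁆ ∘ P⊆) , x∈p∪q⁺ (inj₁ (x∈⁅x⁆ f)))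

    acyclic-cut : ∀ {X f a b} → X ⊆ E H → Acyclic X → f ∈ X → Joins f a b →
                  ∃[ S ] a ∈ S × b ∉ S × Closed (X - f) S
    acyclic-cut X⊆H acyclic f∈X j with cycle⊎cut X⊆H f∈X j
    ... | inj₁ (D , cyc , D⊆X , _) = ⊥-elim (acyclic D cyc D⊆X)
    ... | inj₂ cut                 = cut

  -- For Y closed on S, these are the edges having an end in S.
  star : VertexSet → EdgeSet
  star S = select (λ g → proj₁ (ends g) ∈? S)

  module _ {Y : EdgeSet} {S : VertexSet} (closed : Closed Y S) where

    star-ends : ∀ {g v} → g ∈ Y → g ∈ star S → Incident g v → v ∈ S
    star-ends {g} g∈Y g∈S i
      with incident-ends (joins-ends g) i | ∈-select⁻ (λ g → proj₁ (ends g) ∈? S) g∈S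
    ... | inj₁ refl | ∈S = ∈S
    ... | inj₂ refl | ∈S = closed g∈Y (joins-ends g) ∈S

    incident⇒star : ∀ {g v} → g ∈ Y → Incident g v → v ∈ S → g ∈ star S
    incident⇒star {g} g∈Y i v∈S with incident-ends (joins-ends g) i
    ... | inj₁ refl = ∈-select⁺ (λ g → proj₁ (ends g) ∈? S) v∈S
    ... | inj₂ refl =
      ∈-select⁺ (λ g → proj₁ (ends g) ∈? S) (closed g∈Y (joins-sym (joins-ends g)) v∈S)

  -- Forests: edge counts and leaves

  module _ (H : Subgraph G) where

    -- Deleting an edge `f` splits the forest along a cut. Each side of `W` contains an end of `f`,
    -- so induction applies to both sides; the two units gained pay for `f` and for the claimed one.
    acyclic-bound : ∀ X W → X ⊆ E H → Acyclic H X → (∀ {g v} → g ∈ X → Incident g v → v ∈ W) →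
                    Nonempty W → suc ∣ X ∣ ≤ ∣ W ∣
    acyclic-bound X W = go X W (<-wellFounded ∣ X ∣)
      where
      go : ∀ X W → Acc _<_ ∣ X ∣ → X ⊆ E H → Acyclic H X →
           (∀ {g v} → g ∈ X → Incident g v → v ∈ W) → Nonempty W → suc ∣ X ∣ ≤ ∣ W ∣
      go X W (acc rs) X⊆H acyclic X⊆W ne with nonempty? X
      ... | no empty rewrite Empty-unique empty | ∣⊥∣≡0 size = nonempty⇒0< ne
      ... | yes (f , f∈X) with acyclic-cut H X⊆H acyclic f∈X (joins-ends f)
      ...   | S , a∈S , b∉S , closed = begin
        suc ∣ X ∣                                ≤⟨ s≤s (∣p∣≤1+∣p-x∣ X f) ⟩
        2 + ∣ Y ∣                                ≡⟨ cong (2 +_) (∣p∣≡∣p∩q∣+∣p─q∣ Y (star S)) ⟩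
        2 + (∣ Y ∩ star S ∣ + ∣ Y ─ star S ∣)    ≡⟨ cong suc (sym (+-suc _ _)) ⟩
        suc ∣ Y ∩ star S ∣ + suc ∣ Y ─ star S ∣  ≤⟨ +-mono-≤ inS outS ⟩
        ∣ W ∩ S ∣ + ∣ W ─ S ∣                    ≡⟨ ∣p∣≡∣p∩q∣+∣p─q∣ W S ⟨
        ∣ W ∣                                    ∎
        where
        open ≤-Reasoning
        Y : EdgeSet
        Y = X - f

        Y⊆X : Y ⊆ X
        Y⊆X = p─q⊆p X ⁅ f ⁆

        Y<X : ∣ Y ∣ < ∣ X ∣
        Y<X = x∈p⇒∣p-x∣<∣p∣ f∈X

        inS : suc ∣ Y ∩ star S ∣ ≤ ∣ W ∩ S ∣
        inS = go _ _ (rs (≤-<-trans (∣p∩q∣≤∣p∣ Y (star S)) Y<X)) (X⊆H ∘ ⊆X)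
          (acyclic-⊆ H ⊆X acyclic)
          (λ g∈ i → let (g∈Y , g∈S) = x∈p∩q⁻ Y (star S) g∈ in
             x∈p∩q⁺ (X⊆W (Y⊆X g∈Y) i , star-ends closed g∈Y g∈S i))
          (_ , x∈p∩q⁺ (X⊆W f∈X (joins-left (joins-ends f)) , a∈S))
          where
          ⊆X : Y ∩ star S ⊆ X
          ⊆X = Y⊆X ∘ p∩q⊆p Y (star S)

        outS : suc ∣ Y ─ star S ∣ ≤ ∣ W ─ S ∣
        outS = go _ _ (rs (≤-<-trans (∣p─q∣≤∣p∣ Y (star S)) Y<X)) (X⊆H ∘ ⊆X)
          (acyclic-⊆ H ⊆X acyclic)
          (λ g∈ i → let (g∈Y , g∉S) = x∈p─q⁻ Y (star S) g∈ in
             x∈p∧x∉q⇒x∈p─q (X⊆W (Y⊆X g∈Y) i) (g∉S ∘ incident⇒star closed g∈Y i))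
          (_ , x∈p∧x∉q⇒x∈p─q (X⊆W f∈X (joins-right (joins-ends f))) b∉S)
          where
          ⊆X : Y ─ star S ⊆ X
          ⊆X = Y⊆X ∘ p─q⊆p Y (star S)

  -- Restricting to `T` allows exceptions: deleting an edge may turn its end into a leaf.
  LeaflessOn : (Vertex → Set) → EdgeSet → Set
  LeaflessOn T X = ∀ {v f} → T v → f ∈ X → Incident f v → ¬ Loop f →
                   ∃[ g ] g ∈ X × g ≢ f × Incident g v

  -- Deleting `f` takes an edge only from `c` on this side, so no other vertex there becomes a leaf.
  -- Since `c` was not a leaf before, a further edge at `c` remains.
  cut-side-inhabited : ∀ {X f c d S} → f ∈ X → Joins f c d → c ∈ S → d ∉ S →
    Closed (X - f) S → LeaflessOn (_∈ S) X →
    LeaflessOn (_≢ c) ((X - f) ∩ star S) × Nonempty ((X - f) ∩ star S)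
  cut-side-inhabited {X} {f} {c} {d} {S} f∈X j c∈S d∉S closed leafless = leafless′ , inhabited
    where
    enter : ∀ {g v} → g ∈ X → g ≢ f → Incident g v → v ∈ S → g ∈ (X - f) ∩ star S
    enter g∈X g≢f i v∈S =
      let g∈ = x∈p∧x≢y⇒x∈p-y g∈X g≢f in x∈p∩q⁺ (g∈ , incident⇒star closed g∈ i v∈S)

    leafless′ : LeaflessOn (_≢ c) ((X - f) ∩ star S)
    leafless′ v≢c g∈ i ¬loop with x∈p∩q⁻ (X - f) (star S) g∈
    ... | g∈Y , g∈S with leafless v∈S (p─q⊆p X ⁅ f ⁆ g∈Y) i ¬loop
      where v∈S = star-ends closed g∈Y g∈S i
    ...   | h , h∈X , h≢g , ih = h , enter h∈X h≢f ih v∈S , h≢g , ih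
      where
      v∈S = star-ends closed g∈Y g∈S i
      h≢f : h ≢ f
      h≢f refl = [ v≢c , (λ { refl → d∉S v∈S }) ] (incident-ends j ih)

    inhabited : Nonempty ((X - f) ∩ star S)
    inhabited with leafless c∈S f∈X (joins-left j)
                     (λ l → d∉S (subst (_∈ S) (loop⇒≡ j l) c∈S))
    ... | g , g∈X , g≢f , i = g , enter g∈X g≢f i c∈S

  -- Cut the forest at an edge and keep the side without `x`. Its only possible leaf is the end of
  -- the cut edge, so it is empty by induction, yet it is inhabited.
  one-leaf-acyclic-empty : ∀ (H : Subgraph G) X x → X ⊆ E H → Acyclic H X →
                           LeaflessOn (_≢ x) X → Empty X
  one-leaf-acyclic-empty H X x = go X x (<-wellFounded ∣ X ∣)
    where
    go : ∀ X x → Acc _<_ ∣ X ∣ → X ⊆ E H → Acyclic H X → LeaflessOn (_≢ x) X → Empty X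
    go X x (acc rs) X⊆H acyclic leafless (f , f∈X) =
      no-cut (acyclic-cut H X⊆H acyclic f∈X (joins-ends f))
      where
      side : ∀ {c d S} → Joins f c d → c ∈ S → d ∉ S → x ∉ S → ¬ Closed (X - f) S
      side {c} {S = S} j c∈S d∉S x∉S closed =
        uncurry (go _ c (rs (≤-<-trans (∣p∩q∣≤∣p∣ (X - f) (star S)) (x∈p⇒∣p-x∣<∣p∣ f∈X)))
                   (X⊆H ∘ ⊆X) (acyclic-⊆ H ⊆X acyclic))
          (cut-side-inhabited f∈X j c∈S d∉S closed
            (λ v∈S → leafless (λ { refl → x∉S v∈S })))
        where
        ⊆X : (X - f) ∩ star S ⊆ X
        ⊆X = p─q⊆p X ⁅ f ⁆ ∘ p∩q⊆p (X - f) (star S)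

      no-cut : ¬ (∃[ S ] proj₁ (ends f) ∈ S × proj₂ (ends f) ∉ S × Closed (X - f) S)
      no-cut (S , a∈S , b∉S , closed) with x ∈? S
      ... | no  x∉S = side (joins-ends f) a∈S b∉S x∉S closed
      -- Here the side without `x` is the complement, with the ends of `f` swapped.
      ... | yes x∈S =
        side (joins-sym (joins-ends f)) (x∉p⇒x∈∁p b∉S) (x∈p⇒x∉∁p a∈S) (x∈p⇒x∉∁p x∈S)
          (closed-∁ closed)

  -- The kernel and the unique cycle

  kernel⊆ : ∀ {A Q : Subgraph G} → Star LeafDeletion A Q → E Q ⊆ E A
  kernel⊆ ε g∈ = g∈
  kernel⊆ (_◅_ {i = A} (_ , f , _ , _ , refl) steps) g∈ = p─q⊆p (E A) ⁅ f ⁆ (kernel⊆ steps g∈)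

  -- The edge at a leaf is not on the cycle, which has a second edge at that vertex. The host `H`
  -- stays fixed, so the cycle need not be rebuilt in each smaller subgraph.
  cycle⊆kernel : ∀ {H A Q : Subgraph G} {C} → Cycle H C → C ⊆ E A → Star LeafDeletion A Q → C ⊆ E Q
  cycle⊆kernel cyc C⊆A ε = C⊆A
  cycle⊆kernel {H} {C = C} cyc C⊆A
    (_◅_ {i = A} {j = A′} (v , f , (_ , _ , i , ¬loop , leaf) , _ , E≡) steps) =
    cycle⊆kernel {H} cyc C⊆A′ steps
    where
    f∉C : f ∉ C
    f∉C f∈C with cycle-leafless {H} cyc f∈C i ¬loop
    ... | g , g∈C , g≢f , ig = g≢f (leaf g (C⊆A g∈C) ig)

    C⊆A′ : C ⊆ E A′
    C⊆A′ {g} g∈C = subst (g ∈_) (sym E≡) (x∈p∧x≢y⇒x∈p-y (C⊆A g∈C) (λ { refl → f∉C g∈C }))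

  no-leaf⇒leafless : ∀ (Q : Subgraph G) → (∀ v f → ¬ Leaf Q v f) → LeaflessOn (λ _ → Unit.⊤) (E Q)
  no-leaf⇒leafless Q no-leaf {v} {f} _ f∈Q i ¬loop
    with any? (λ g → (g ∈? E Q) ×-dec (¬? (g ≟F f) ×-dec incident? g v))
  ... | yes g   = g
  ... | no none = ⊥-elim (no-leaf v f
    (Subgraph.closed Q f v f∈Q i , f∈Q , i , ¬loop , only))
    where
    only : ∀ g → g ∈ E Q → Incident g v → g ≡ f
    only g g∈Q ig with g ≟F f
    ... | yes g≡f = g≡f
    ... | no  g≢f = ⊥-elim (none (g , g∈Q , g≢f , ig))

  module _ {A : Subgraph G} {C} (cyc : Cycle A C) (unique : ∀ C′ → Cycle A C′ → C′ ≡ C) where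

    cycle-free⇒acyclic : ∀ {X c} → c ∈ C → c ∉ X → Acyclic A X
    cycle-free⇒acyclic {c = c} c∈C c∉X D cycD D⊆X =
      c∉X (D⊆X (subst (c ∈_) (sym (unique D cycD)) c∈C))

    -- An edge f of the kernel off the cycle would cut it into two sides; the
    -- one without the chosen cycle edge is a forest with at most one leaf.
    kernel⊆cycle : ∀ {Q} → Kernel A Q → E Q ⊆ C
    kernel⊆cycle {Q} (steps , no-leaf) {f} f∈Q = on-cycle (cycle⊎cut A Q⊆A f∈Q (joins-ends f))
      where
      Q⊆A : E Q ⊆ E A
      Q⊆A = kernel⊆ steps

      c = proj₁ (cycle-nonempty {A} cyc)
      c∈C = proj₂ (cycle-nonempty {A} cyc)

      side : ∀ {p q S} → Joins f p q → p ∈ S → q ∉ S → proj₁ (ends c) ∉ S → ¬ Closed (E Q - f) S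
      side {p} {S = S} j p∈S q∉S c∉S closed =
        uncurry (one-leaf-acyclic-empty A _ p ⊆A (cycle-free⇒acyclic c∈C
            (λ c∈ → c∉S (∈-select⁻ (λ g → proj₁ (ends g) ∈? S) (proj₂ (x∈p∩q⁻ _ _ c∈))))))
          (cut-side-inhabited f∈Q j p∈S q∉S closed (λ _ → no-leaf⇒leafless Q no-leaf _))
        where
        ⊆A : (E Q - f) ∩ star S ⊆ E A
        ⊆A = Q⊆A ∘ p─q⊆p (E Q) ⁅ f ⁆ ∘ p∩q⊆p (E Q - f) (star S)

      on-cycle : (∃[ D ] Cycle A D × D ⊆ E Q × f ∈ D) ⊎
                 (∃[ S ] proj₁ (ends f) ∈ S × proj₂ (ends f) ∉ S × Closed (E Q - f) S) → f ∈ C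
      on-cycle (inj₁ (D , cycD , _ , f∈D)) = subst (f ∈_) (unique D cycD) f∈D
      on-cycle (inj₂ (S , p∈S , q∉S , closed)) with proj₁ (ends c) ∈? S
      ... | no  c∉S = ⊥-elim (side (joins-ends f) p∈S q∉S c∉S closed)
      ... | yes c∈S = ⊥-elim
        (side (joins-sym (joins-ends f)) (x∉p⇒x∈∁p q∉S) (x∈p⇒x∉∁p p∈S) (x∈p⇒x∉∁p c∈S)
          (closed-∁ closed))

  -- Deleting a cycle edge; components

  module _ {H : Subgraph G} {e : Edge} where

    include : ∀ {u v} → Walk (H ∖ e) u v → Walk H u v
    include (stop v∈)       = stop v∈
    include (step f f∈ j P) = step f (p─q⊆p (E H) ⁅ e ⁆ f∈) j (include P)

    vertices-include : ∀ {u v} (P : Walk (H ∖ e) u v) → vertices (include P) ≡ vertices P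
    vertices-include (stop _)       = refl
    vertices-include (step _ _ _ P) = cong (_ List.∷_) (vertices-include P)

    edges-include : ∀ {u v} (P : Walk (H ∖ e) u v) → edges (include P) ≡ edges P
    edges-include (stop _)       = refl
    edges-include (step f _ _ P) = cong (⁅ f ⁆ ∪_) (edges-include P)

    cycle-include : ∀ {C} → Cycle (H ∖ e) C → Cycle H C
    cycle-include (u , v , P , f , uniq , f∈ , j , f∉P , C≡) =
      u , v , include P , f , subst Unique (sym (vertices-include P)) uniq ,
      p─q⊆p (E H) ⁅ e ⁆ f∈ , j , f∉P ∘ subst (f ∈_) (edges-include P) ,
      trans C≡ (cong (⁅ f ⁆ ∪_) (sym (edges-include P)))

  -- Every use of `e` in a walk is rerouted around the rest of the cycle. A cycle avoiding `e` would
  -- be a cycle of `A`, hence equal to `C`, which contains `e`.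
  unicyclic-delete-tree : ∀ {A : Subgraph G} {C e} → ConnectedGraph A → Cycle A C →
                          (∀ C′ → Cycle A C′ → C′ ≡ C) → e ∈ C → Tree (A ∖ e)
  unicyclic-delete-tree {A} {C} {e} (ne , connected) cyc unique e∈C =
    (ne , λ u v u∈ v∈ → linked⇒walk (A ∖ e) id u∈
       (linked-mono (edges⊆ (connected u v u∈ v∈)) (walk⇒linked (connected u v u∈ v∈))
          Star.>>= avoid)) ,
    λ D cycD → proj₂ (x∈p-y⁻ (E A) e
      (cycle⊆ {A ∖ e} cycD (subst (e ∈_) (sym (unique D (cycle-include {A} cycD))) e∈C))) refl
    where
    avoid : ∀ {u v} → Linked (E A) u v → Star (Linked (E A - e)) u v
    avoid (f , f∈A , j) with f ≟F e
    ... | no  f≢e  = (f , x∈p∧x≢y⇒x∈p-y f∈A f≢e , j) ◅ ε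
    ... | yes refl = linked-mono C-e⊆ (cycle-detour {A} cyc e∈C j)
      where
      C-e⊆ : C - e ⊆ E A - e
      C-e⊆ g∈ with x∈p-y⁻ C e g∈
      ... | g∈C , g≢e = x∈p∧x≢y⇒x∈p-y (cycle⊆ {A} cyc g∈C) g≢e

  -- Adding `g` and its other end to `A` keeps it connected and inside the host, so maximality puts
  -- `g` in `A` already.
  component-closed : ∀ {B} {A : Subgraph G} → Component (G ⟨ B ⟩) A →
                     ∀ {g v} → g ∈ B → v ∈ V A → Incident g v → g ∈ E A
  component-closed {B} {A} ((VA⊆ , EA⊆) , (ne , connected) , maximal) {g} {v} g∈B v∈A i =
    proj₂ (maximal A′ (V⊆ , E⊆) (((v , p⊆p∪q _ v∈A) , connected′))
             (p⊆p∪q _ , p⊆p∪q ⁅ g ⁆)) (y∈p∪⁅y⁆ (E A) g)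
    where
    w = proj₁ (incident⇒joins i)
    j = proj₂ (incident⇒joins i)

    A′ : Subgraph G
    A′ = record
      { V      = V A ∪ ⁅ w ⁆
      ; E      = E A ∪ ⁅ g ⁆
      ; closed = λ f x f∈ ix → closed′ f x (x∈p∪⁅y⁆⁻ (E A) g f∈) ix
      }
      where
      closed′ : ∀ f x → f ∈ E A ⊎ f ≡ g → Incident f x → x ∈ V A ∪ ⁅ w ⁆
      closed′ f x (inj₁ f∈A) ix = p⊆p∪q ⁅ w ⁆ (Subgraph.closed A f x f∈A ix)
      closed′ f x (inj₂ refl) ix with incident-ends j ix
      ... | inj₁ refl = p⊆p∪q ⁅ w ⁆ v∈A
      ... | inj₂ refl = y∈p∪⁅y⁆ (V A) w

    V⊆ : V A′ ⊆ cover B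
    V⊆ = p∪q⊆r VA⊆ (⁅x⁆⊆p (∈-select⁺ (covered? B) (g , g∈B , joins-right j)))

    E⊆ : E A′ ⊆ B
    E⊆ = p∪q⊆r EA⊆ (⁅x⁆⊆p g∈B)

    -- Any two vertices are then joined through the hub `v`.
    from-v : ∀ {x} → x ∈ V A′ → Star (Linked (E A′)) v x
    from-v x∈ with x∈p∪⁅y⁆⁻ (V A) w x∈
    ... | inj₁ x∈A  = linked-mono (p⊆p∪q ⁅ g ⁆ ∘ edges⊆ P) (walk⇒linked P)
      where P = connected v _ v∈A x∈A
    ... | inj₂ refl = (g , y∈p∪⁅y⁆ (E A) g , j) ◅ ε

    connected′ : ∀ x y → x ∈ V A′ → y ∈ V A′ → Walk A′ x y
    connected′ x y x∈ y∈ = linked⇒walk A′ id x∈ (linked-sym (from-v x∈) ◅◅ from-v y∈)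

-- Circuits of `M k G`

module _ (k : ℕ) (G : Graph) where
  open Graph G
  open Matroid (M k G)

  independent⊎circuit : ∀ X → Independent X ⊎ ∃[ C ] Circuit C × C ⊆ X
  independent⊎circuit X with anySubset? (λ Y → candidate? k G Y ×-dec (Y ⊆? X))
  ... | no none = inj₁ (λ C cC C⊆X → none (C , proj₁ cC , C⊆X))
  ... | yes (Y , cY , Y⊆X) with minimal-below (candidate? k G) Y cY
  ...   | C , cC , C⊆Y = inj₂ (C , cC , ⊆-trans C⊆Y Y⊆X)

  -- Passing from `C` to `C ─ Z` loses at least as many covered vertices as edges, since the
  -- remaining edges avoid `W`. The excess `k` over the cover therefore survives.
  circuit-outside : ∀ {C Z W} → 1 ≤ k → Circuit C → ∣ C ∩ Z ∣ ≤ ∣ cover C ∩ W ∣ →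
         (∀ {g v} → g ∈ C ─ Z → Incident g v → v ∉ W) → ∃[ D ] Circuit D × D ⊆ C ─ Z
  circuit-outside {C} {Z} {W} 1≤k ((_ , ∣C∣) , _) small apart =
    circuit-below k G (C ─ Z) (0<⇒nonempty (≤-trans 1≤k (≤-trans (m≤n+m k _) big))) big
    where
    open ≤-Reasoning
    cover⊆ : cover (C ─ Z) ⊆ cover C ─ W
    cover⊆ v∈ with ∈-select⁻ (covered? (C ─ Z)) v∈
    ... | g , g∈ , i = x∈p∧x∉q⇒x∈p─q
      (∈-select⁺ (covered? C) (g , p─q⊆p C Z g∈ , i)) (apart g∈ i)

    big : ∣ cover (C ─ Z) ∣ + k ≤ ∣ C ─ Z ∣
    big = +-cancelˡ-≤ ∣ C ∩ Z ∣ _ _ (begin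
      ∣ C ∩ Z ∣ + (∣ cover (C ─ Z) ∣ + k)
        ≤⟨ +-mono-≤ small (+-monoˡ-≤ k (p⊆q⇒∣p∣≤∣q∣ cover⊆)) ⟩
      ∣ cover C ∩ W ∣ + (∣ cover C ─ W ∣ + k)  ≡⟨ +-assoc (∣ cover C ∩ W ∣) _ k ⟨
      ∣ cover C ∩ W ∣ + ∣ cover C ─ W ∣ + k    ≡⟨ cong (_+ k) (∣p∣≡∣p∩q∣+∣p─q∣ (cover C) W) ⟨
      ∣ cover C ∣ + k                          ≡⟨ ∣C∣ ⟨
      ∣ C ∣                                    ≡⟨ ∣p∣≡∣p∩q∣+∣p─q∣ C Z ⟩
      ∣ C ∩ Z ∣ + ∣ C ─ Z ∣                    ∎)

-- The fundamental cocircuit of an edge on the cycle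

mainTheorem19 : (G : Graph) → let open Graph G in
    (k : ℕ) → 1 ≤ k → let open Matroid (M k G) in
    Connected →
    (B : EdgeSet) → Base B →
    (e : Edge) → e ∈ B →
    (A : Subgraph G) → Component (G ⟨ B ⟩) A → e ∈ E A →
    (C : EdgeSet) → Cycle A C → (∀ C′ → Cycle A C′ → C′ ≡ C) →
    (∀ Q → Kernel A Q → (e ∈ C ⇔ e ∈ E Q)) ×
    (e ∈ C →
    Tree (A ∖ e) ×
    (∃[ K ] FundamentalCocircuit B e K ×
    (∀ u → u ∈ K ⇔ (u ≡ e ⊎ (u ∉ B × (∃[ v ] v ∈ V A × Incident u v))))))
mainTheorem19 G k 1≤k _ B base e e∈B A comp e∈A C cyc unique =
  -- The kernel has the same edges as the cycle: leaf deletion spares the cycle and leaves nothing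
  -- else.
  (λ Q ker → mk⇔ (cycle⊆kernel {H = A} cyc (cycle⊆ {H = A} cyc) (proj₁ ker))
                 (kernel⊆cycle cyc unique ker)) ,
  λ e∈C → unicyclic-delete-tree (proj₁ (proj₂ comp)) cyc unique e∈C ,
    K , cocircuit e∈C , λ u → mk⇔ (∈-select⁻ inK?) (∈-select⁺ inK?)
  where
  open Graph G
  open Matroid (M k G)

  InK : Edge → Set
  InK u = u ≡ e ⊎ (u ∉ B × (∃[ v ] v ∈ V A × Incident u v))

  inK? : Decidable InK
  inK? u = (u ≟F e) ⊎-dec
    (¬? (u ∈? B) ×-dec any? (λ v → (v ∈? V A) ×-dec incident? u v))

  K : EdgeSet
  K = select inK?

  K∩B⊆e : ∀ {u} → u ∈ K → u ∈ B → u ≡ e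
  K∩B⊆e u∈K u∈B with ∈-select⁻ inK? u∈K
  ... | inj₁ u≡e       = u≡e
  ... | inj₂ (u∉B , _) = ⊥-elim (u∉B u∈B)

  outside-A : ∀ {g v} → g ∈ B → g ∉ E A → Incident g v → v ∉ V A
  outside-A g∈B g∉A i v∈A = g∉A (component-closed comp g∈B v∈A i)

  module _ (e∈C : e ∈ C) where

    forest-bound : ∀ {D} → Nonempty (cover D ∩ V A) →
                   suc ∣ D ∩ (E A - e) ∣ ≤ ∣ cover D ∩ V A ∣
    forest-bound {D} = acyclic-bound A (D ∩ (E A - e)) _ ⊆A
      (cycle-free⇒acyclic cyc unique e∈C
        (λ e∈ → proj₂ (x∈p-y⁻ (E A) e (p∩q⊆q D (E A - e) e∈)) refl))
      (λ {g} {v} g∈ i → x∈p∩q⁺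
        ( ∈-select⁺ (covered? D) (g , p∩q⊆p D (E A - e) g∈ , i)
        , Subgraph.closed A g v (⊆A g∈) i))
      where
      ⊆A : D ∩ (E A - e) ⊆ E A
      ⊆A = p─q⊆p (E A) ⁅ e ⁆ ∘ p∩q⊆q D (E A - e)

    -- The spare unit of `forest-bound` pays for one extra edge `x`, whose end `v` also makes the
    -- vertex set nonempty. The extra edge is `u` in `e∈circuit` and `e` in `e∉circuit`.
    bound : ∀ {D Z x v} → D ∩ Z ⊆ (D ∩ (E A - e)) ∪ ⁅ x ⁆ → x ∈ D → Incident x v → v ∈ V A →
            ∣ D ∩ Z ∣ ≤ ∣ cover D ∩ V A ∣
    bound {D} {Z} {x} {v} D∩Z⊆ x∈D i v∈A = begin
      ∣ D ∩ Z ∣                       ≤⟨ ∣p∣≤1+∣p-x∣ (D ∩ Z) x ⟩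
      suc ∣ D ∩ Z - x ∣               ≤⟨ s≤s (p⊆q⇒∣p∣≤∣q∣ D∩Z-x⊆) ⟩
      suc ∣ D ∩ (E A - e) ∣           ≤⟨ forest-bound (v , x∈p∩q⁺
                                           (∈-select⁺ (covered? D) (x , x∈D , i) , v∈A)) ⟩
      ∣ cover D ∩ V A ∣               ∎
      where
      open ≤-Reasoning
      D∩Z-x⊆ : D ∩ Z - x ⊆ D ∩ (E A - e)
      D∩Z-x⊆ y∈ with x∈p-y⁻ (D ∩ Z) x y∈
      ... | y∈D∩Z , y≢x = [ id , ⊥-elim ∘ y≢x ] (x∈p∪⁅y⁆⁻ (D ∩ (E A - e)) x (D∩Z⊆ y∈D∩Z))

    e∈circuit : ∀ {u D} → u ∈ K → u ∉ B → Circuit D → D ⊆ B ∪ ⁅ u ⁆ → e ∈ D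
    e∈circuit {u} {D} u∈K u∉B cD D⊆ with ∈-select⁻ inK? u∈K
    ... | inj₁ refl = ⊥-elim (u∉B e∈B)
    ... | inj₂ (_ , v , v∈A , i) with e ∈? D | u ∈? D
    ...   | yes e∈D | _       = e∈D
    ...   | no  _   | no  u∉D = ⊥-elim (proj₁ base D cD (p⊆q∪⁅x⁆∧x∉p⇒p⊆q D⊆ u∉D))
    ...   | no  e∉D | yes u∈D =
      ⊥-elim (proj₁ base _ (proj₁ (proj₂ smaller)) (D─Z⊆B ∘ proj₂ (proj₂ smaller)))
      where
      -- Discarding `u` along with `A` leaves a remainder inside `B`, where no circuit can lie.
      Z : EdgeSet
      Z = E A ∪ ⁅ u ⁆

      D─Z⊆B : D ─ Z ⊆ B
      D─Z⊆B g∈ with x∈p─q⁻ D Z g∈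
      ... | g∈D , g∉Z with x∈p∪⁅y⁆⁻ B u (D⊆ g∈D)
      ...   | inj₁ g∈B  = g∈B
      ...   | inj₂ refl = ⊥-elim (g∉Z (y∈p∪⁅y⁆ (E A) u))

      D∩Z⊆ : D ∩ Z ⊆ (D ∩ (E A - e)) ∪ ⁅ u ⁆
      D∩Z⊆ g∈ with x∈p∩q⁻ D Z g∈
      ... | g∈D , g∈Z with x∈p∪⁅y⁆⁻ (E A) u g∈Z
      ...   | inj₁ g∈A  =
        x∈p∪q⁺ (inj₁ (x∈p∩q⁺ (g∈D , x∈p∧x≢y⇒x∈p-y g∈A (λ { refl → e∉D g∈D }))))
      ...   | inj₂ refl = y∈p∪⁅y⁆ (D ∩ (E A - e)) u

      smaller = circuit-outside k G 1≤k cD (bound D∩Z⊆ u∈D i v∈A)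
        (λ g∈ → outside-A (D─Z⊆B g∈) (x∈p─q⇒x∉q D Z g∈ ∘ p⊆p∪q ⁅ u ⁆))

    e∉circuit : ∀ {u D} → u ∉ K → u ∉ B → Circuit D → D ⊆ B ∪ ⁅ u ⁆ → e ∉ D
    e∉circuit {u} {D} u∉K u∉B cD D⊆ e∈D = x∈p─q⇒x∉q D (E A) (F⊆ e∈F) e∈A
      where
      apart : ∀ {g v} → g ∈ D ─ E A → Incident g v → v ∉ V A
      apart g∈ i v∈A with x∈p─q⁻ D (E A) g∈
      ... | g∈D , g∉A with x∈p∪⁅y⁆⁻ B u (D⊆ g∈D)
      ...   | inj₁ g∈B  = outside-A g∈B g∉A i v∈A
      -- An end of `u` in `A` would put `u` into `K`.
      ...   | inj₂ refl = u∉K (∈-select⁺ inK? (inj₂ (u∉B , _ , v∈A , i)))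

      D∩A⊆ : D ∩ E A ⊆ (D ∩ (E A - e)) ∪ ⁅ e ⁆
      D∩A⊆ {g} g∈ with x∈p∩q⁻ D (E A) g∈ | g ≟F e
      ... | g∈D , g∈A | yes refl = y∈p∪⁅y⁆ (D ∩ (E A - e)) e
      ... | g∈D , g∈A | no  g≢e  = x∈p∪q⁺ (inj₁ (x∈p∩q⁺ (g∈D , x∈p∧x≢y⇒x∈p-y g∈A g≢e)))

      smaller = circuit-outside k G 1≤k cD
        (bound D∩A⊆ e∈D (inj₁ refl) (Subgraph.closed A e _ e∈A (inj₁ refl))) apart
      F  = proj₁ smaller
      F⊆ = proj₂ (proj₂ smaller)

      -- Minimality of `D` forces `F` to equal `D`, although `F` avoids all edges of `A`.
      e∈F : e ∈ F
      e∈F = subst (e ∈_)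
        (sym (proj₂ cD F (proj₁ (proj₁ (proj₂ smaller))) (p─q⊆p D (E A) ∘ F⊆))) e∈D

    cocircuit : FundamentalCocircuit B e K
    cocircuit = fundamental-cocircuit (M k G) (independent⊎circuit k G) base e∈B
      (∈-select⁺ inK? (inj₁ refl)) K∩B⊆e e∈circuit e∉circuit
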